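{- For every integer $n\ge 2$, the friendship graph $F_n$ satisfies $\operatorname{st}_{\gamma_{st}}(F_n)=1$.
   Context: All graphs are finite, simple and undirected. For a graph $G=(V,E)$, a set $D\subseteq V$ is a strong dominating set if every vertex $v\in V\setminus D$ is adjacent to some $u\in D$ with $\deg(v)\le\deg(u)$ (degrees taken in $G$). The strong domination number $\gamma_{st}(G)$ is the minimum size of a strong dominating set. For $S\subseteq V$, $G-S$ is the graph obtained by deleting the vertices of $S$. The stability of the strong domination number is $\operatorname{st}_{\gamma_{st}}(G)=\min\{|S| : S\subseteq V,\ \gamma_{st}(G-S)\ne\gamma_{st}(G)\}$. The friendship graph $F_n$ is obtained by identifying one vertex from each of $n$ copies of the triangle $C_3$; equivalently it is the join $K_1\vee nK_2$ of a single vertex with $n$ disjoint edges. -}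

module Defs where

open import Data.Fin using (Fin; zero; suc; quotient)
open import Data.Fin.Properties using (all?; any?) renaming (_≟_ to _≟F_)
open import Data.Fin.Subset
  using (Subset; inside; outside; _∈_; _∉_; _⊆_; _─_; _-_; ∣_∣; Nonempty; Empty) renaming (⊤ to full)
open import Data.Fin.Subset.Properties
  using (_∈?_; _⊆?_; anySubset?; ∈⊤; x∈p∧x∉q⇒x∈p─q; x∈p⇒∣p-x∣<∣p∣; Empty-unique; ∣⊥∣≡0)
open import Data.Empty using (⊥; ⊥-elim)
open import Data.Unit using (⊤; tt)
open import Data.Nat using (ℕ; suc; _*_; _≤_; _<_)
open import Data.Nat.Properties using (_≟_; _≤?_; _<?_; ≮⇒≥; n≮0)
open import Data.Nat.Induction using (<-wellFounded)
open import Data.Product using (∃; ∃-syntax; _×_; _,_; proj₁)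
open import Data.Vec using (tabulate; _∷_; there)
open import Function using (id)
open import Induction.WellFounded using (Acc; acc)
open import Level using (0ℓ)
open import Relation.Binary.Core using (Rel)
import Relation.Binary.Definitions as B
open import Relation.Binary.PropositionalEquality
  using (_≡_; _≢_; refl; sym; trans; cong; subst; ≢-sym)
open import Relation.Nullary using (¬_; Dec; yes; no; does; ¬?; _×-dec_; _→-dec_)
open import Relation.Unary using (Pred; Decidable)

-- Finite simple undirected graphs.  The vertex set is a subset of an ambient
-- Fin N, so that deleting vertices needs no relabelling.
record Graph (N : ℕ) : Set₁ where
  field
    V         : Subset N
    Adj       : Rel (Fin N) 0ℓ
    adj?      : B.Decidable Adj
    adj-sym   : B.Symmetric Adj
    adj-irr   : ∀ {v} → ¬ Adj v v
    adj-inV   : ∀ {u v} → Adj u v → u ∈ V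

  neighbours : Fin N → Subset N
  neighbours v = tabulate (λ u → does (adj? v u))

  deg : Fin N → ℕ
  deg v = ∣ neighbours v ∣

open Graph public

infixl 6 _-ᵍ_

_-ᵍ_ : ∀ {N} → Graph N → Subset N → Graph N
G -ᵍ S = record
  { V       = V G ─ S
  ; Adj     = λ u v → Adj G u v × u ∉ S × v ∉ S
  ; adj?    = λ u v → adj? G u v ×-dec ¬? (u ∈? S) ×-dec ¬? (v ∈? S)
  ; adj-sym = λ (uv , u∉S , v∉S) → adj-sym G uv , v∉S , u∉S
  ; adj-irr = λ (vv , _) → adj-irr G vv
  ; adj-inV = λ (uv , u∉S , _) → x∈p∧x∉q⇒x∈p─q (adj-inV G uv) u∉S
  }

IsMinSize : ∀ {N} → Pred (Subset N) 0ℓ → ℕ → Set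
IsMinSize P k = (∃[ A ] P A × ∣ A ∣ ≡ k) × (∀ A → P A → k ≤ ∣ A ∣)

minSize : ∀ {N} {P : Pred (Subset N) 0ℓ} → Decidable P → ∃ P → ∃ (IsMinSize P)
minSize {N} {P} P? (A₀ , pA₀) = go A₀ pA₀ (<-wellFounded ∣ A₀ ∣)
  where
  go : ∀ A → P A → Acc _<_ ∣ A ∣ → ∃ (IsMinSize P)
  go A pA (acc rec) with anySubset? (λ B → P? B ×-dec (∣ B ∣ <? ∣ A ∣))
  ... | yes (B , pB , B<A) = go B pB (rec B<A)
  ... | no none = ∣ A ∣ , (A , pA , refl) , λ B pB → ≮⇒≥ (λ B<A → none (B , pB , B<A))

StrongDominating : ∀ {N} → Graph N → Pred (Subset N) 0ℓ
StrongDominating G D =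
  D ⊆ V G × (∀ v → v ∈ V G → v ∉ D → ∃[ u ] u ∈ D × Adj G v u × deg G v ≤ deg G u)

strongDominating? : ∀ {N} (G : Graph N) → Decidable (StrongDominating G)
strongDominating? G D =
  (D ⊆? V G) ×-dec
  all? (λ v → (v ∈? V G) →-dec ¬? (v ∈? D) →-dec
    any? (λ u → (u ∈? D) ×-dec adj? G v u ×-dec (deg G v ≤? deg G u)))

V-strongDominating : ∀ {N} (G : Graph N) → StrongDominating G (V G)
V-strongDominating G = id , λ v v∈V v∉V → ⊥-elim (v∉V v∈V)

γst-min : ∀ {N} (G : Graph N) → ∃ (IsMinSize (StrongDominating G))
γst-min G = minSize (strongDominating? G) (V G , V-strongDominating G)

γst : ∀ {N} → Graph N → ℕ
γst G = proj₁ (γst-min G)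

Changesγst : ∀ {N} → Graph N → Pred (Subset N) 0ℓ
Changesγst G S = S ⊆ V G × γst (G -ᵍ S) ≢ γst G

changesγst? : ∀ {N} (G : Graph N) → Decidable (Changesγst G)
changesγst? G S = (S ⊆? V G) ×-dec ¬? (γst (G -ᵍ S) ≟ γst G)

∣Empty∣≡0 : ∀ {N} {p : Subset N} → Empty p → ∣ p ∣ ≡ 0
∣Empty∣≡0 {N} e = trans (cong ∣_∣ (Empty-unique e)) (∣⊥∣≡0 N)

∣Nonempty∣≢0 : ∀ {N} {p : Subset N} → Nonempty p → ∣ p ∣ ≢ 0
∣Nonempty∣≢0 {p = p} (x , x∈p) ∣p∣≡0 =
  n≮0 (subst (∣ p - x ∣ <_) ∣p∣≡0 (x∈p⇒∣p-x∣<∣p∣ x∈p))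

p─p-Empty : ∀ {N} (p : Subset N) → Empty (p ─ p)
p─p-Empty (inside  ∷ p) (suc x , there x∈) = p─p-Empty p (x , x∈)
p─p-Empty (outside ∷ p) (suc x , there x∈) = p─p-Empty p (x , x∈)

γst-Empty : ∀ {N} (G : Graph N) → Empty (V G) → γst G ≡ 0
γst-Empty G e with γst-min G
... | _ , (D , (D⊆V , _) , refl) , _ = ∣Empty∣≡0 λ (x , x∈D) → e (x , D⊆V x∈D)

γst-Nonempty : ∀ {N} (G : Graph N) → Nonempty (V G) → γst G ≢ 0
γst-Nonempty G (x , x∈V) with γst-min G
... | _ , (D , (_ , dom) , refl) , _ with x ∈? D
...   | yes x∈D = ∣Nonempty∣≢0 (x , x∈D)
...   | no  x∉D = let (u , u∈D , _) = dom x x∈V x∉D in ∣Nonempty∣≢0 (u , u∈D)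

-- Deleting every vertex leaves the null graph, whose γst is 0, so the family
-- minimised over in the stability is inhabited as soon as V G is.
V-changesγst : ∀ {N} (G : Graph N) → Nonempty (V G) → Changesγst G (V G)
V-changesγst G ne = id , λ eq →
  γst-Nonempty G ne (trans (sym eq) (γst-Empty (G -ᵍ V G) (p─p-Empty (V G))))

stγst-min : ∀ {N} (G : Graph N) → Nonempty (V G) → ∃ (IsMinSize (Changesγst G))
stγst-min G ne = minSize (changesγst? G) (V G , V-changesγst G ne)

stγst : ∀ {N} (G : Graph N) → Nonempty (V G) → ℕ
stγst G ne = proj₁ (stγst-min G ne)

-- K₁ ∨ nK₂: zero is the K₁, and suc i, suc j lie in the same K₂ exactly when i
-- and j agree after division by 2.
FAdj : ∀ n → Rel (Fin (suc (n * 2))) 0ℓ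
FAdj n zero    zero    = ⊥
FAdj n zero    (suc _) = ⊤
FAdj n (suc _) zero    = ⊤
FAdj n (suc i) (suc j) = i ≢ j × quotient {n} 2 i ≡ quotient {n} 2 j

fAdj? : ∀ n → B.Decidable (FAdj n)
fAdj? n zero    zero    = no id
fAdj? n zero    (suc _) = yes tt
fAdj? n (suc _) zero    = yes tt
fAdj? n (suc i) (suc j) = ¬? (i ≟F j) ×-dec (quotient {n} 2 i ≟F quotient {n} 2 j)

fAdj-sym : ∀ n → B.Symmetric (FAdj n)
fAdj-sym n {zero}  {suc _} _         = tt
fAdj-sym n {suc _} {zero}  _         = tt
fAdj-sym n {suc _} {suc _} (i≢j , q) = ≢-sym i≢j , sym q

fAdj-irr : ∀ n {v} → ¬ FAdj n v v
fAdj-irr n {suc _} (i≢i , _) = i≢i refl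

friendship : ∀ n → Graph (suc (n * 2))
friendship n = record
  { V       = full
  ; Adj     = FAdj n
  ; adj?    = fAdj? n
  ; adj-sym = λ {u} {v} → fAdj-sym n {u} {v}
  ; adj-irr = fAdj-irr n
  ; adj-inV = λ _ → ∈⊤
  }

friendship-nonempty : ∀ n → Nonempty (V (friendship n))
friendship-nonempty n = zero , ∈⊤

{-# OPTIONS --safe #-}

-- The centre of F_n is adjacent to every other vertex, so it dominates alone and
-- γst (F_n) = 1.  Deleting it leaves n ≥ 2 disjoint edges, each of which needs its
-- own dominating vertex, so the deletion of one vertex changes γst; deleting none
-- does not.
module Submission where

open import Defs
open import Data.Fin using (Fin; zero; suc; quotient)
open import Data.Fin.Properties using (suc-injective) renaming (_≟_ to _≟F_)
open import Data.Fin.Subset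
  using (Subset; Nonempty; _∈_; _⊆_; ∣_∣; ⁅_⁆; ∁) renaming (⊥ to ∅)
open import Data.Fin.Subset.Properties
  using (_∈?_; ∈⊤; ∉⊥; Empty-unique; x∈⁅x⁆; x∈⁅y⁆⇒x≡y; ∣⁅x⁆∣≡1; ∣∁p∣≡n∸∣p∣;
         x∉p⇒x∈∁p; x∈∁p⇒x∉p; p⊆q⇒∣p∣≤∣q∣; p─⊥≡p; x∈p∧x∉q⇒x∈p─q; x∈p∧x≢y⇒x∈p-y;
         x∈p⇒∣p-x∣<∣p∣)
open import Data.Nat using (ℕ; suc; _*_; _≤_; _<_; _∸_; z≤n; s≤s)
open import Data.Nat.Properties
  using (≤-antisym; ≤-reflexive; ≤-trans; ≤-<-trans; <⇒≱; <⇒≢; ≰⇒>; n≢0⇒n>0)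
open import Data.Product using (∃-syntax; _×_; _,_; proj₁; proj₂)
open import Data.Vec.Properties using (lookup∘tabulate; []=⇒lookup; lookup⇒[]=)
open import Function using (case_of_)
open import Relation.Binary.PropositionalEquality
  using (_≡_; _≢_; refl; sym; trans; cong; subst)
open import Relation.Nullary using (yes; no; does; contradiction)
open import Relation.Nullary.Decidable using (dec-true; decidable-stable)

private
  variable
    N : ℕ

∣∁⁅x⁆∣≡N∸1 : (x : Fin N) → ∣ ∁ ⁅ x ⁆ ∣ ≡ N ∸ 1
∣∁⁅x⁆∣≡N∸1 {N} x = trans (∣∁p∣≡n∸∣p∣ ⁅ x ⁆) (cong (N ∸_) (∣⁅x⁆∣≡1 x))

x∈p⇒0<∣p∣ : ∀ {p : Subset N} {x} → x ∈ p → 0 < ∣ p ∣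
x∈p⇒0<∣p∣ x∈p = n≢0⇒n>0 (∣Nonempty∣≢0 (_ , x∈p))

∣p∣≡0⇒p≡∅ : ∀ {p : Subset N} → ∣ p ∣ ≡ 0 → p ≡ ∅
∣p∣≡0⇒p≡∅ ∣p∣≡0 = Empty-unique λ ne → ∣Nonempty∣≢0 ne ∣p∣≡0

-- If `x` and `y` differed, `x` would survive in `p - y`, giving `0 < ∣ p - y ∣ < ∣ p ∣` and hence
-- at least two elements.
∣p∣≤1⇒x≡y : ∀ {p : Subset N} {x y} → ∣ p ∣ ≤ 1 → x ∈ p → y ∈ p → x ≡ y
∣p∣≤1⇒x≡y {x = x} {y} ∣p∣≤1 x∈p y∈p = decidable-stable (x ≟F y) λ x≢y →
  <⇒≱ (≤-<-trans (x∈p⇒0<∣p∣ (x∈p∧x≢y⇒x∈p-y x∈p x≢y)) (x∈p⇒∣p-x∣<∣p∣ y∈p)) ∣p∣≤1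

∈-neighbours⁺ : (G : Graph N) → ∀ {v u} → Adj G v u → u ∈ neighbours G v
∈-neighbours⁺ G {v} {u} vu =
  lookup⇒[]= u _ (trans (lookup∘tabulate _ u) (dec-true (adj? G v u) vu))

∈-neighbours⁻ : (G : Graph N) → ∀ {v u} → u ∈ neighbours G v → Adj G v u
∈-neighbours⁻ G {v} {u} u∈
  -- Abstracting the decision together with the lookup equation turns the latter into `false ≡ true`
  -- in the `no` branch.
  with adj? G v u
     | trans (sym (lookup∘tabulate (λ w → does (adj? G v w)) u)) ([]=⇒lookup u∈)
... | yes vu | _ = vu
... | no _   | ()

deg-mono : (G H : Graph N) → ∀ {v} → (∀ {u} → Adj G v u → Adj H v u) → deg G v ≤ deg H v
deg-mono G H G⊆H = p⊆q⇒∣p∣≤∣q∣ λ u∈ → ∈-neighbours⁺ H (G⊆H (∈-neighbours⁻ G u∈))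

deg≤N∸1 : (G : Graph N) → ∀ v → deg G v ≤ N ∸ 1
deg≤N∸1 G v = ≤-trans (p⊆q⇒∣p∣≤∣q∣ neighbours⊆) (≤-reflexive (∣∁⁅x⁆∣≡N∸1 v))
  where
  neighbours⊆ : neighbours G v ⊆ ∁ ⁅ v ⁆
  neighbours⊆ u∈ = x∉p⇒x∈∁p λ u∈⁅v⁆ →
    adj-irr G (subst (Adj G v) (x∈⁅y⁆⇒x≡y v u∈⁅v⁆) (∈-neighbours⁻ G u∈))

universal-deg : (G : Graph N) → ∀ {u} → (∀ v → v ≢ u → Adj G u v) → N ∸ 1 ≤ deg G u
universal-deg G {u} univ = ≤-trans (≤-reflexive (sym (∣∁⁅x⁆∣≡N∸1 u))) (p⊆q⇒∣p∣≤∣q∣ λ {v} v∈ →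
  ∈-neighbours⁺ G (univ v λ { refl → x∈∁p⇒x∉p v∈ (x∈⁅x⁆ u) }))

-- A vertex adjacent to all others attains the largest possible degree `N ∸ 1`, so the degree
-- condition holds against every `v`.
universal-strongDominating : (G : Graph N) → ∀ {u} → u ∈ V G →
  (∀ v → v ≢ u → Adj G u v) → StrongDominating G ⁅ u ⁆
universal-strongDominating G {u} u∈V univ =
  (λ x∈ → subst (_∈ V G) (sym (x∈⁅y⁆⇒x≡y u x∈)) u∈V) ,
  λ v _ v∉ → u , x∈⁅x⁆ u , adj-sym G (univ v λ { refl → v∉ (x∈⁅x⁆ u) }) ,
    ≤-trans (deg≤N∸1 G v) (universal-deg G univ)

γst≤ : (G : Graph N) → ∀ {D} → StrongDominating G D → γst G ≤ ∣ D ∣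
γst≤ G = proj₂ (proj₂ (γst-min G)) _

γst-attained : (G : Graph N) → ∃[ D ] StrongDominating G D × ∣ D ∣ ≡ γst G
γst-attained G = proj₁ (proj₂ (γst-min G))

γst-mono : (G H : Graph N) →
  (∀ {D} → StrongDominating H D → StrongDominating G D) → γst G ≤ γst H
γst-mono G H H⇒G =
  let (_ , sd , eq) = γst-attained H in ≤-trans (γst≤ G (H⇒G sd)) (≤-reflexive eq)

universal⇒γst≡1 : (G : Graph N) → ∀ {u} → u ∈ V G →
  (∀ v → v ≢ u → Adj G u v) → γst G ≡ 1
universal⇒γst≡1 G {u} u∈V univ = ≤-antisym
  (≤-trans (γst≤ G (universal-strongDominating G u∈V univ)) (≤-reflexive (∣⁅x⁆∣≡1 u)))
  (n≢0⇒n>0 (γst-Nonempty G (u , u∈V)))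

-- The two graphs agree only up to `p─⊥≡p` on vertices and trivial `∉⊥` proofs on edges, so strong
-- dominating sets are carried across in both directions. Degrees are compared by two inequalities.
γst-ᵍ∅ : (G : Graph N) → γst (G -ᵍ ∅) ≡ γst G
γst-ᵍ∅ G = ≤-antisym (γst-mono (G -ᵍ ∅) G to) (γst-mono G (G -ᵍ ∅) from)
  where
  deg≤ : ∀ v → deg (G -ᵍ ∅) v ≤ deg G v
  deg≤ v = deg-mono (G -ᵍ ∅) G proj₁

  deg≥ : ∀ v → deg G v ≤ deg (G -ᵍ ∅) v
  deg≥ v = deg-mono G (G -ᵍ ∅) λ vu → vu , ∉⊥ , ∉⊥

  to : ∀ {D} → StrongDominating G D → StrongDominating (G -ᵍ ∅) D
  to {D} (D⊆V , dom) = subst (D ⊆_) (sym (p─⊥≡p (V G))) D⊆V , λ v v∈ v∉D →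
    let (u , u∈D , vu , d) = dom v (subst (v ∈_) (p─⊥≡p (V G)) v∈) v∉D
    in u , u∈D , (vu , ∉⊥ , ∉⊥) , ≤-trans (deg≤ v) (≤-trans d (deg≥ u))

  from : ∀ {D} → StrongDominating (G -ᵍ ∅) D → StrongDominating G D
  from {D} (D⊆V , dom) = subst (D ⊆_) (p─⊥≡p (V G)) D⊆V , λ v v∈ v∉D →
    let (u , u∈D , (vu , _) , d) = dom v (subst (v ∈_) (sym (p─⊥≡p (V G))) v∈) v∉D
    in u , u∈D , vu , ≤-trans (deg≥ v) (≤-trans d (deg≤ u))

γst-friendship : ∀ n → γst (friendship n) ≡ 1
γst-friendship n = universal⇒γst≡1 (friendship n) ∈⊤
  λ { zero 0≢0 → contradiction refl 0≢0 ; (suc _) _ → _ }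

-- Without the centre, the only neighbour of a vertex is its partner in the same K₂, so a vertex
-- outside `D` must be dominated by that partner.
K₂-meets : ∀ n {D} → StrongDominating (friendship n -ᵍ ⁅ zero ⁆) D →
  ∀ i → ∃[ j ] suc j ∈ D × quotient {n} 2 i ≡ quotient {n} 2 j
K₂-meets n {D} (_ , dom) i with suc i ∈? D
... | yes i∈D = i , i∈D , refl
... | no  i∉D with dom (suc i) (x∈p∧x∉q⇒x∈p─q ∈⊤ λ i∈ → case x∈⁅y⁆⇒x≡y zero i∈ of λ ()) i∉D
-- The centre cannot be the dominator: adjacency after the deletion requires it to lie outside the
-- deleted set.
...   | zero  , _   , (_ , _ , 0∉) , _ = contradiction (x∈⁅x⁆ zero) 0∉
...   | suc j , j∈D , ((_ , q) , _) , _ = j , j∈D , q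

friendship-centre-1<∣D∣ : ∀ {n D} → 2 ≤ n →
  StrongDominating (friendship n -ᵍ ⁅ zero ⁆) D → 1 < ∣ D ∣
friendship-centre-1<∣D∣ {n@(suc (suc _))} (s≤s (s≤s z≤n)) sd = ≰⇒> λ ∣D∣≤1 →
  -- Indices 0 and 2 lie in the first and second K₂, both present since `n` is at least 2. If `D`
  -- had at most one element, a single vertex would meet both, equating the quotients 0 and 1.
  let (j , j∈D , q) = K₂-meets n sd zero
      (k , k∈D , r) = K₂-meets n sd (suc (suc zero))
      j≡k = suc-injective (∣p∣≤1⇒x≡y ∣D∣≤1 j∈D k∈D)
  in case trans q (trans (cong (quotient {n} 2) j≡k) (sym r)) of λ ()

1<γst-friendship-centre : ∀ {n} → 2 ≤ n → 1 < γst (friendship n -ᵍ ⁅ zero ⁆)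
1<γst-friendship-centre {n} 2≤n =
  let (_ , sd , eq) = γst-attained (friendship n -ᵍ ⁅ zero ⁆)
  in ≤-trans (friendship-centre-1<∣D∣ 2≤n sd) (≤-reflexive eq)

stγst≤ : (G : Graph N) (ne : Nonempty (V G)) → ∀ {S} → Changesγst G S → stγst G ne ≤ ∣ S ∣
stγst≤ G ne = proj₂ (proj₂ (stγst-min G ne)) _

-- A minimiser of size 0 would be `∅`, whose deletion leaves `γst` unchanged.
stγst>0 : (G : Graph N) (ne : Nonempty (V G)) → 0 < stγst G ne
stγst>0 G ne =
  let (S , (_ , changes) , eq) = proj₁ (proj₂ (stγst-min G ne))
  in n≢0⇒n>0 λ st≡0 → changes
       (trans (cong (λ T → γst (G -ᵍ T)) (∣p∣≡0⇒p≡∅ (trans eq st≡0))) (γst-ᵍ∅ G))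

proposition2p6 : ∀ (n : ℕ) → 2 ≤ n → stγst (friendship n) (friendship-nonempty n) ≡ 1
proposition2p6 n 2≤n = ≤-antisym
  (≤-trans (stγst≤ (friendship n) (friendship-nonempty n) centre-changes)
           (≤-reflexive (∣⁅x⁆∣≡1 {suc (n * 2)} zero)))
  (stγst>0 (friendship n) (friendship-nonempty n))
  where
  centre-changes : Changesγst (friendship n) ⁅ zero ⁆
  centre-changes = (λ _ → ∈⊤) , λ eq →
    <⇒≢ (1<γst-friendship-centre 2≤n) (sym (trans eq (γst-friendship n)))
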